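{- Let $K_{m_1,m_2}$ be the complete bipartite graph with bipartition $(X,Y)$, $X=\{x_1,\dots,x_{m_1}\}$, $Y=\{y_1,\dots,y_{m_2}\}$, where $2\le m_1\le m_2$. Let $s$ and $i$ be integers with $\max\{1,s-m_2\}\le i\le \min\{m_1,s-1\}$ and $s\ge m_2-m_1+3$, and let $S_i=\{x_1,\dots,x_i,y_1,\dots,y_{s-i}\}$. If $2i> m_1+s-m_2$, then $$\kappa^*_{K_{m_1,m_2}}(S_i)\ge\begin{cases} m_1-i+\left\lfloor\frac{i}{2}\right\rfloor, & \text{if } m_1+s-m_2<2i\le \frac{4(m_1+s-m_2)}{3},\\[2pt] m_2-s+i, & \text{if } \frac{4(m_1+s-m_2)}{3}<2i\le 2(m_1+s-m_2),\\[2pt] m_1, & \text{if } 2i>2(m_1+s-m_2).\end{cases}$$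
   Context: For $S\subseteq V(G)$ with $|S|\ge 2$, an $S$-Steiner tree of $G$ is a subtree $T$ of $G$ with $S\subseteq V(T)$ all of whose leaves belong to $S$. A family of $S$-Steiner trees $T_1,\dots,T_k$ is completely independent if for all $1\le p<q\le k$: $E(T_p)\cap E(T_q)=\emptyset$, $V(T_p)\cap V(T_q)=S$, and for any two vertices $x_1,x_2\in S$ the $(x_1,x_2)$-paths in $T_p$ and in $T_q$ are internally disjoint. $\kappa^*_G(S)$ is the maximum number of trees in a completely independent family of $S$-Steiner trees in $G$. -}

module Defs where

open import Data.Empty using (⊥)
open import Data.Fin as Fin using (Fin; zero; suc; toℕ; splitAt)
open import Data.Fin.Properties as Finₚ using (any?; all?; injective⇒≤)
open import Data.Fin.Subset using (Subset; inside; outside; _∈_; _⊆_; _∩_; ∣_∣; Nonempty)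
open import Data.Fin.Subset.Properties using (_∈?_; _⊆?_; anySubset?)
open import Data.List as List using (List; []; _∷_; _++_; [_]; length)
open import Data.List.Membership.Propositional.Properties using (∈-lookup)
open import Data.List.Properties using (length-++-≤ˡ)
open import Data.List.Relation.Binary.Disjoint.Propositional using (Disjoint)
open import Data.List.Relation.Unary.All as All using ()
open import Data.List.Relation.Unary.AllPairs using ([]; _∷_)
open import Data.List.Relation.Unary.Linked as Linked using (Linked; linked?)
open import Data.List.Relation.Unary.Unique.Propositional using (Unique)
open import Data.Nat as ℕ using (ℕ; zero; suc; _+_; _≤_; _<ᵇ_; z≤n; s≤s)
open import Data.Nat.Properties as ℕₚ using (≤-trans; n≤1+n; m≤n⇒m<n∨m≡n; ≤-pred)
open import Data.Product using (Σ; ∃; ∃-syntax; _×_; _,_; proj₁; proj₂)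
open import Data.Sum using (_⊎_; inj₁; inj₂; [_,_]′)
open import Data.Unit using (⊤; tt)
open import Data.Vec using (Vec; []; _∷_; lookup; tabulate; here; there)
open import Data.Vec.Properties using (lookup∘tabulate)
open import Function using (_∘_; const)
open import Relation.Binary.Definitions using (tri<; tri≈; tri>)
open import Relation.Binary.PropositionalEquality
  using (_≡_; _≢_; refl; sym; subst; subst₂; cong)
open import Relation.Nullary using (¬_; Dec; yes; no; contradiction)
open import Relation.Nullary.Decidable using (map′; ¬?; _×-dec_; _→-dec_; _⊎-dec_)
open import Relation.Unary using (Decidable)
open import Data.List.Membership.Propositional using () renaming (_∈_ to _∈ˡ_)
import Data.Bool.Properties as Boolₚ
import Data.List.Membership.DecPropositional as DecMem
import Data.List.Relation.Unary.Unique.DecPropositional as DecUnique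
import Data.Vec.Properties as Vecₚ

private variable
  n : ℕ

infix 4 _∈ˡ?_

_∈ˡ?_ : ∀ (v : Fin n) vs → Dec (v ∈ˡ vs)
_∈ˡ?_ = DecMem._∈?_ Finₚ._≟_

record Graph (n : ℕ) : Set₁ where
  field
    _~_     : Fin n → Fin n → Set
    ~-sym   : ∀ {u v} → u ~ v → v ~ u
    ~-irrefl : ∀ {v} → ¬ (v ~ v)
    _~?_    : ∀ u v → Dec (u ~ v)

-- The raw data of a candidate subgraph: a vertex set and, for every u, the
-- set of vertices joined to u.  Well-formedness is `IsSubgraph` below.

record Sub (n : ℕ) : Set where
  constructor sub
  field
    verts : Subset n
    nbrs  : Vec (Subset n) n

open Sub public

Edge : Sub n → Fin n → Fin n → Set
Edge T u v = v ∈ lookup (nbrs T) u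

degree : Sub n → Fin n → ℕ
degree T v = ∣ lookup (nbrs T) v ∣

IsLeaf : Sub n → Fin n → Set
IsLeaf T v = v ∈ verts T × degree T v ≡ 1

record IsSubgraph (G : Graph n) (T : Sub n) : Set where
  field
    edge-sym  : ∀ u v → Edge T u v → Edge T v u
    edge-vert : ∀ u v → Edge T u v → u ∈ verts T
    edge-adj  : ∀ u v → Edge T u v → Graph._~_ G u v

-- `Path T u v is`: a path of T with distinct ends u and v (distinctness is
-- part of `Unique`), where `is` lists its internal vertices in order.

Path : Sub n → Fin n → Fin n → List (Fin n) → Set
Path T u v is = Linked (Edge T) (u ∷ is ++ [ v ]) × Unique (u ∷ is ++ [ v ])

Connected : Sub n → Set
Connected T = ∀ u v → u ∈ verts T → v ∈ verts T → u ≢ v → ∃[ is ] Path T u v is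

-- A cycle is a path with at least one internal vertex together with an edge
-- joining its ends.

Acyclic : Sub n → Set
Acyclic T = ¬ (∃[ u ] ∃[ v ] ∃[ is ] Path T u v is × (is ≢ [] × Edge T v u))

record IsSteinerTree (G : Graph n) (S : Subset n) (T : Sub n) : Set where
  field
    isSubgraph : IsSubgraph G T
    connected  : Connected T
    acyclic    : Acyclic T
    spans      : S ⊆ verts T
    leaves     : ∀ v → IsLeaf T v → v ∈ S

record Independent (S : Subset n) (T T′ : Sub n) : Set where
  field
    edge-disjoint  : ∀ u v → ¬ (Edge T u v × Edge T′ u v)
    verts-meet     : verts T ∩ verts T′ ≡ S
    paths-disjoint : ∀ x₁ x₂ → x₁ ∈ S → x₂ ∈ S → ∀ is js →
                     Path T x₁ x₂ is → Path T′ x₁ x₂ js → Disjoint is js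

record IsCIFamily (G : Graph n) (S : Subset n) {k : ℕ} (T : Fin k → Sub n) : Set where
  field
    steiner     : ∀ p → IsSteinerTree G S (T p)
    independent : ∀ p q → p Fin.< q → Independent S (T p) (T q)

HasCIFamily : Graph n → Subset n → ℕ → Set
HasCIFamily {n} G S k = Σ (Fin k → Sub n) (IsCIFamily G S)

IsMaximum : (ℕ → Set) → ℕ → Set
IsMaximum P m = P m × (∀ k → P k → k ≤ m)

Searchable : Set → Set₁
Searchable A = ∀ {P : A → Set} → Decidable P → Dec (∃ P)

searchVec : ∀ {A} → Searchable A → ∀ k → Searchable (Vec A k)
searchVec s zero    P? = map′ ([] ,_) (λ { ([] , p) → p }) (P? [])
searchVec s (suc k) P? =
  map′ (λ { (x , xs , p) → (x ∷ xs) , p }) (λ { ((x ∷ xs) , p) → x , xs , p })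
       (s (λ x → searchVec s k (λ xs → P? (x ∷ xs))))

searchSub : Searchable (Sub n)
searchSub P? =
  map′ (λ { (V , E , p) → sub V E , p }) (λ { (sub V E , p) → V , E , p })
       (anySubset? (λ V → searchVec anySubset? _ (λ E → P? (sub V E))))

searchList : ∀ b {P : List (Fin n) → Set} → Decidable P → Dec (∃[ l ] length l ≤ b × P l)
searchList zero    P? = map′ (λ p → [] , z≤n , p) (λ { ([] , _ , p) → p }) (P? [])
searchList (suc b) P? =
  map′ (λ { (inj₁ p) → [] , z≤n , p ; (inj₂ (x , l , b≥ , p)) → x ∷ l , s≤s b≥ , p })
       (λ { ([] , _ , p) → inj₁ p ; (x ∷ l , s≤s b≥ , p) → inj₂ (x , l , b≥ , p) })
       (P? [] ⊎-dec any? (λ x → searchList b (λ l → P? (x ∷ l))))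

unique-lookup : ∀ {xs : List (Fin n)} → Unique xs → ∀ i j →
                List.lookup xs i ≡ List.lookup xs j → i ≡ j
unique-lookup (_ ∷ _)  zero    zero    _  = refl
unique-lookup (p ∷ _)  zero    (suc j) eq = contradiction eq (All.lookup p (∈-lookup j))
unique-lookup (p ∷ _)  (suc i) zero    eq = contradiction (sym eq) (All.lookup p (∈-lookup i))
unique-lookup (_ ∷ ps) (suc i) (suc j) eq = cong suc (unique-lookup ps i j eq)

unique-length : ∀ {xs : List (Fin n)} → Unique xs → length xs ≤ n
unique-length u = injective⇒≤ (unique-lookup u _ _)

path-length : ∀ (T : Sub n) {u v is} → Path T u v is → length is ≤ n
path-length _ {is = is} (_ , uq) =
  ≤-trans (≤-trans (length-++-≤ˡ is) (n≤1+n _)) (unique-length uq)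

edge? : (T : Sub n) → ∀ u v → Dec (Edge T u v)
edge? T u v = v ∈? lookup (nbrs T) u

path? : (T : Sub n) → ∀ u v is → Dec (Path T u v is)
path? T u v is = linked? (edge? T) _ ×-dec DecUnique.unique? Finₚ._≟_ _

searchPath : (T : Sub n) → ∀ u v {P : List (Fin n) → Set} → Decidable P →
             Dec (∃[ is ] Path T u v is × P is)
searchPath T u v P? =
  map′ (λ { (is , _ , p) → is , p }) (λ { (is , p , q) → is , path-length T p , p , q })
       (searchList _ (λ is → path? T u v is ×-dec P? is))

isSubgraph? : (G : Graph n) → Decidable (IsSubgraph G)
isSubgraph? G T =
  map′ (λ { (a , b , c) → record { edge-sym = a ; edge-vert = b ; edge-adj = c } })
       (λ r → let open IsSubgraph r in edge-sym , edge-vert , edge-adj)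
       ( all? (λ u → all? λ v → edge? T u v →-dec edge? T v u)
       ×-dec all? (λ u → all? λ v → edge? T u v →-dec (u ∈? verts T))
       ×-dec all? (λ u → all? λ v → edge? T u v →-dec Graph._~?_ G u v))

connected? : Decidable (Connected {n})
connected? T = all? λ u → all? λ v → (u ∈? verts T) →-dec ((v ∈? verts T) →-dec
  (¬? (u Finₚ.≟ v) →-dec
   map′ (λ { (is , p , _) → is , p }) (λ { (is , p) → is , p , tt })
        (searchPath T u v {const ⊤} (λ _ → yes tt))))

nonNil? : Decidable {A = List (Fin n)} (_≢ [])
nonNil? []      = no (λ ne → ne refl)
nonNil? (_ ∷ _) = yes λ ()

acyclic? : Decidable (Acyclic {n})
acyclic? T = ¬? (any? λ u → any? λ v → searchPath T u v (λ is → nonNil? is ×-dec edge? T v u))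

isSteinerTree? : (G : Graph n) (S : Subset n) → Decidable (IsSteinerTree G S)
isSteinerTree? G S T =
  map′ (λ { (a , b , c , d , e) → record
            { isSubgraph = a ; connected = b ; acyclic = c ; spans = λ {x} → d {x} ; leaves = e } })
       (λ r → let open IsSteinerTree r in isSubgraph , connected , acyclic , (λ {x} → spans {x}) , leaves)
       ( isSubgraph? G T ×-dec connected? T ×-dec acyclic? T ×-dec (S ⊆? verts T)
       ×-dec all? (λ v → ((v ∈? verts T) ×-dec (degree T v ℕₚ.≟ 1)) →-dec (v ∈? S)))

Clash : (T T′ : Sub n) (x₁ x₂ : Fin n) → Set
Clash T T′ x₁ x₂ = ∃[ is ] Path T x₁ x₂ is × (∃[ js ] Path T′ x₁ x₂ js ×
  (∃[ v ] v ∈ˡ is × v ∈ˡ js))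

clash? : (T T′ : Sub n) → ∀ x₁ x₂ → Dec (Clash T T′ x₁ x₂)
clash? T T′ x₁ x₂ =
  searchPath T x₁ x₂ λ is → searchPath T′ x₁ x₂ λ js →
    any? λ v → (v ∈ˡ? is) ×-dec (v ∈ˡ? js)

independent? : (S : Subset n) → ∀ T T′ → Dec (Independent S T T′)
independent? S T T′ =
  map′ (λ { (a , b , c) → record
            { edge-disjoint = a ; verts-meet = b
            ; paths-disjoint = λ x₁ x₂ x₁∈ x₂∈ is js P Q {v} (v∈is , v∈js) →
                c x₁ x₂ x₁∈ x₂∈ (is , P , js , Q , v , v∈is , v∈js) } })
       (λ r → let open Independent r in edge-disjoint , verts-meet ,
          λ x₁ x₂ x₁∈ x₂∈ (is , P , js , Q , v , v∈is , v∈js) →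
            paths-disjoint x₁ x₂ x₁∈ x₂∈ is js P Q (v∈is , v∈js))
       ( all? (λ u → all? λ v → ¬? (edge? T u v ×-dec edge? T′ u v))
       ×-dec Vecₚ.≡-dec Boolₚ._≟_ _ _
       ×-dec all? (λ x₁ → all? λ x₂ → (x₁ ∈? S) →-dec ((x₂ ∈? S) →-dec ¬? (clash? T T′ x₁ x₂))))

isCIFamily? : ∀ (G : Graph n) S {k} (T : Fin k → Sub n) → Dec (IsCIFamily G S T)
isCIFamily? G S T =
  map′ (λ { (a , b) → record { steiner = a ; independent = b } })
       (λ r → let open IsCIFamily r in steiner , independent)
       ( all? (λ p → isSteinerTree? G S (T p))
       ×-dec all? (λ p → all? λ q → (p Finₚ.<? q) →-dec independent? S (T p) (T q)))

isCIFamily-resp : ∀ {G : Graph n} {S k} {T T′ : Fin k → Sub n} → (∀ p → T p ≡ T′ p) →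
                  IsCIFamily G S T → IsCIFamily G S T′
isCIFamily-resp {G = G} {S} eq r = record
  { steiner     = λ p → subst (IsSteinerTree G S) (eq p) (steiner p)
  ; independent = λ p q p<q → subst₂ (Independent S) (eq p) (eq q) (independent p q p<q) }
  where open IsCIFamily r

hasCIFamily? : (G : Graph n) (S : Subset n) → Decidable (HasCIFamily G S)
hasCIFamily? G S k =
  map′ (λ { (Ts , r) → lookup Ts , r })
       (λ { (T , r) → tabulate T , isCIFamily-resp (λ p → sym (lookup∘tabulate T p)) r })
       (searchVec searchSub k (λ Ts → isCIFamily? G S (lookup Ts)))

-- The largest k ≤ b satisfying P, with the convention that it is 0 if there
-- is none.

greatest : ∀ {P : ℕ → Set} → Decidable P → ℕ → ℕ
greatest P? zero    = 0
greatest P? (suc b) with P? (suc b)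
... | yes _ = suc b
... | no  _ = greatest P? b

-- Restricting the search to k ≤ n loses nothing once |S| ≥ 2: by
-- `κ*-isMaximum` below, κ* G S is then the maximum over all k.

κ* : Graph n → Subset n → ℕ
κ* {n} G S = greatest (hasCIFamily? G S) n

greatest-holds : ∀ {P : ℕ → Set} (P? : Decidable P) → P 0 → ∀ b → P (greatest P? b)
greatest-holds P? p₀ zero    = p₀
greatest-holds P? p₀ (suc b) with P? (suc b)
... | yes p = p
... | no  _ = greatest-holds P? p₀ b

greatest-bound : ∀ {P : ℕ → Set} (P? : Decidable P) → ∀ b k → k ≤ b → P k → k ≤ greatest P? b
greatest-bound P? zero    k k≤b p = k≤b
greatest-bound {P} P? (suc b) k k≤b p with P? (suc b)
... | yes _  = k≤b
... | no ¬p with m≤n⇒m<n∨m≡n k≤b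
...   | inj₁ k<1+b = greatest-bound P? b k (≤-pred k<1+b) p
...   | inj₂ k≡1+b = contradiction (subst P k≡1+b p) ¬p

emptyFamily : (G : Graph n) (S : Subset n) → HasCIFamily G S 0
emptyFamily G S = (λ ()) , record { steiner = λ () ; independent = λ () }

nonempty : (S : Subset n) → 1 ≤ ∣ S ∣ → Nonempty S
nonempty (inside  ∷ S) _  = zero , here
nonempty (outside ∷ S) 1≤ with nonempty S 1≤
... | x , x∈S = suc x , there x∈S

twoMembers : (S : Subset n) → 2 ≤ ∣ S ∣ → ∃[ x ] ∃[ y ] x ∈ S × y ∈ S × x ≢ y
twoMembers (inside  ∷ S) (s≤s 1≤) with nonempty S 1≤
... | y , y∈S = zero , suc y , here , there y∈S , λ ()
twoMembers (outside ∷ S) 2≤ with twoMembers S 2≤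
... | x , y , x∈S , y∈S , x≢y =
  suc x , suc y , there x∈S , there y∈S , x≢y ∘ Finₚ.suc-injective

firstEdge : ∀ (T : Sub n) {u v} is → Path T u v is → ∃[ w ] Edge T u w
firstEdge _ []      (l , _) = _ , Linked.head l
firstEdge _ (_ ∷ _) (l , _) = _ , Linked.head l

-- Each tree of the family has an edge at a fixed vertex x of S, and these
-- edges are distinct.

family-size : (G : Graph n) (S : Subset n) → 2 ≤ ∣ S ∣ → ∀ k → HasCIFamily G S k → k ≤ n
family-size {n} G S 2≤ k (T , r) with twoMembers S 2≤
... | x , y , x∈S , y∈S , x≢y = injective⇒≤ injective
  where
  open IsCIFamily r
  module _ (p : Fin k) where
    open IsSteinerTree (steiner p)
    edgeAt : ∃[ w ] Edge (T p) x w
    edgeAt with connected x y (spans x∈S) (spans y∈S) x≢y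
    ... | is , P = firstEdge (T p) is P

  other : Fin k → Fin n
  other p = proj₁ (edgeAt p)

  apart : ∀ p q → p Fin.< q → other p ≢ other q
  apart p q p<q eq = Independent.edge-disjoint (independent p q p<q) x (other p)
    (proj₂ (edgeAt p) , subst (Edge (T q) x) (sym eq) (proj₂ (edgeAt q)))

  injective : ∀ {p q} → other p ≡ other q → p ≡ q
  injective {p} {q} eq with Finₚ.<-cmp p q
  ... | tri< p<q _ _ = contradiction eq (apart p q p<q)
  ... | tri≈ _ p≡q _ = p≡q
  ... | tri> _ _ q<p = contradiction (sym eq) (apart q p q<p)

κ*-isMaximum : (G : Graph n) (S : Subset n) → 2 ≤ ∣ S ∣ → IsMaximum (HasCIFamily G S) (κ* G S)
κ*-isMaximum {n} G S 2≤ =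
  greatest-holds (hasCIFamily? G S) (emptyFamily G S) n ,
  λ k f → greatest-bound (hasCIFamily? G S) n k (family-size G S 2≤ k f) f

-- On Fin (m₁ + m₂) the first m₁ vertices form X and the other m₂ form Y.

Opposite : ∀ {A B : Set} → A ⊎ B → A ⊎ B → Set
Opposite (inj₁ _) (inj₂ _) = ⊤
Opposite (inj₂ _) (inj₁ _) = ⊤
Opposite _        _        = ⊥

K : ∀ m₁ m₂ → Graph (m₁ + m₂)
K m₁ m₂ = record
  { _~_      = λ u v → Opposite (splitAt m₁ u) (splitAt m₁ v)
  ; ~-sym    = λ {u} {v} → symm (splitAt m₁ u) (splitAt m₁ v)
  ; ~-irrefl = λ {v} → irrefl (splitAt m₁ v)
  ; _~?_     = λ u v → dec (splitAt m₁ u) (splitAt m₁ v)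
  }
  where
  symm : ∀ {A B : Set} (a b : A ⊎ B) → Opposite a b → Opposite b a
  symm (inj₁ _) (inj₂ _) _ = tt
  symm (inj₂ _) (inj₁ _) _ = tt

  irrefl : ∀ {A B : Set} (a : A ⊎ B) → ¬ Opposite a a
  irrefl (inj₁ _) ()
  irrefl (inj₂ _) ()

  dec : ∀ {A B : Set} (a b : A ⊎ B) → Dec (Opposite a b)
  dec (inj₁ _) (inj₁ _) = no λ ()
  dec (inj₁ _) (inj₂ _) = yes tt
  dec (inj₂ _) (inj₁ _) = yes tt
  dec (inj₂ _) (inj₂ _) = no λ ()

-- {x₁, …, xₐ, y₁, …, y_b}; x_j and y_j have 0-based index j − 1.

initial : ∀ m₁ m₂ (a b : ℕ) → Subset (m₁ + m₂)
initial m₁ m₂ a b =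
  tabulate (λ v → [ (λ j → toℕ j <ᵇ a) , (λ j → toℕ j <ᵇ b) ]′ (splitAt m₁ v))

{-# OPTIONS --safe #-}

-- Let p ≤ q be the numbers of vertices outside S on the two sides.  Pairing
-- outside vertices across the bipartition gives p double stars with all of S
-- as leaves, leaving r = q ∸ p vertices on the Y side.  Such a vertex w
-- together with one x ∈ S spans a tree: w takes all x's in S, and x takes all
-- y's in S; this gives min(r, i) further trees.  When 2r ≤ i more is possible:
-- give each tree a pair of hubs x, x′ instead of one x, distributing its
-- leaves over the pair by parity, and add ⌊i/2⌋ ∸ r trees that replace w by a
-- pair of hubs y, y′ in S.  Trees whose sets of non-leaves are disjoint are
-- completely independent as soon as they share no edges and no vertices
-- outside S.

module Submission where

open import Defs
open import Data.Nat using (ℕ; _+_; _∸_; _*_; _≤_; _≥_; _<_; _>_; _⊔_; _⊓_; ⌊_/2⌋)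
open import Data.Product using (_×_)

open import Data.Bool using (Bool; true; false; not; if_then_else_; T)
open import Data.Bool.Properties using (T-≡; not-¬; not-involutive)
open import Data.Empty using (⊥)
open import Data.Fin using (Fin; splitAt; join; combine; inject≤; fromℕ<; toℕ; zero; suc)
open import Data.Fin.Properties
  using (_≟_; +↔⊎; <⇒≢; splitAt-join; inject≤-injective; toℕ-inject≤; combine-injectiveˡ; toℕ-combine)
open import Data.Fin.Subset using (Subset; _∈_; ∣_∣)
open import Data.Fin.Subset.Properties
  using (x∈p⇒∣p-x∣<∣p∣; x∈p∧x≢y⇒x∈p-y; ⊆-antisym; x∈p∩q⁺; x∈p∩q⁻)
open import Data.List using (List; []; _∷_; _++_; [_])
open import Data.List.Membership.Propositional using () renaming (_∈_ to _∈ˡ_; _∉_ to _∉ˡ_)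
open import Data.List.Membership.Propositional.Properties using (∈-++⁺ˡ; ∈-++⁺ʳ; ∈-++⁻)
open import Data.List.Relation.Unary.All as All using ()
open import Data.List.Relation.Unary.All.Properties using (¬Any⇒All¬)
open import Data.List.Relation.Unary.AllPairs using ([]; _∷_; head)
open import Data.List.Relation.Unary.Any using (here; there)
open import Data.List.Relation.Unary.Linked using ([-]; _∷_)
open import Data.Maybe using (Maybe; just; nothing)
open import Data.Maybe.Properties using (just-injective) renaming (≡-dec to maybe-dec)
open import Data.Nat using (zero; suc; z≤n; s≤s; _<ᵇ_; ⌈_/2⌉; _≤?_)
open import Data.Nat.Induction using (<-wellFounded)
open import Data.Nat.Properties hiding (_≟_; <⇒≢)
open import Data.Nat.Solver using (module +-*-Solver)
open import Data.Product using (∃-syntax; _,_; proj₁; proj₂)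
open import Data.Sum as Sum using (_⊎_; inj₁; inj₂)
open import Data.Sum.Function.Propositional using (_⊎-↔_)
open import Data.Sum.Properties using (inj₁-injective; inj₂-injective) renaming (≡-dec to sum-dec)
open import Data.Unit using (⊤; tt)
open import Data.Vec using (tabulate; lookup)
open import Data.Vec.Properties using (lookup∘tabulate; lookup⇒[]=; []=⇒lookup)
open import Function using (_∘_; _↔_; Inverse; Equivalence)
open import Function.Construct.Composition using (_↔-∘_)
open import Function.Construct.Identity using (↔-id)
open import Induction.WellFounded using (Acc; acc)
open import Level using (0ℓ)
open import Relation.Binary.Construct.Closure.ReflexiveTransitive
  using (Star; _◅_; _◅◅_; gmap; reverse) renaming (ε to stay)
open import Relation.Binary.Definitions using (DecidableEquality; Symmetric)
open import Relation.Binary.PropositionalEquality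
  using (_≡_; _≢_; refl; sym; trans; cong; cong₂; subst; subst₂; module ≡-Reasoning)
open import Relation.Nullary using (¬_; Dec; yes; no; does; contradiction)
open import Relation.Nullary.Decidable using (_×-dec_; _⊎-dec_; dec-true)
open import Relation.Unary using (Pred; Decidable)
open import Data.List.Extrema ≤-totalOrder using (argmax; argmax-sel; f[⊥]≤f[argmax]; f[xs]≤f[argmax])

open +-*-Solver using (solve; _:+_; _:*_; _:=_; con)

private variable
  n : ℕ

2≤∣p∣ : ∀ {p : Subset n} {x y} → x ∈ p → y ∈ p → x ≢ y → 2 ≤ ∣ p ∣
2≤∣p∣ x∈p y∈p x≢y =
  ≤-trans (s≤s (≤-trans (s≤s z≤n) (x∈p⇒∣p-x∣<∣p∣ (x∈p∧x≢y⇒x∈p-y x∈p x≢y)))) (x∈p⇒∣p-x∣<∣p∣ y∈p)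

separate : ∀ {P : Pred (Fin n) 0ℓ} → Decidable P → Subset n
separate P? = tabulate (does ∘ P?)

module _ {P : Pred (Fin n) 0ℓ} (P? : Decidable P) where

  ∈-separate⁺ : ∀ {v} → P v → v ∈ separate P?
  ∈-separate⁺ {v} p = lookup⇒[]= v _ (trans (lookup∘tabulate _ v) (dec-true (P? v) p))

  ∈-separate⁻ : ∀ {v} → v ∈ separate P? → P v
  ∈-separate⁻ {v} v∈ with P? v | trans (sym (lookup∘tabulate (does ∘ P?) v)) ([]=⇒lookup v∈)
  ... | yes p | _ = p

module _ (T : Sub n) where

  path-suffix : ∀ {u v w} is → u ∈ˡ w ∷ is → Path T w v is → ∃[ js ] Path T u v js
  path-suffix is       (here refl) P                 = is , P
  path-suffix (x ∷ is) (there u∈)  (_ ∷ es , _ ∷ us) = path-suffix is u∈ (es , us)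

  walk⇒path : ∀ {u v} → Star (Edge T) u v → u ≢ v → ∃[ is ] Path T u v is
  walk⇒path stay u≢v = contradiction refl u≢v
  walk⇒path {u} {v} (_◅_ {j = w} e es) u≢v with w ≟ v
  ... | yes refl = [] , e ∷ [-] , (u≢v All.∷ All.[]) ∷ All.[] ∷ []
  ... | no w≢v with walk⇒path es w≢v
  ...   | is , P@(ls , us) with u ∈ˡ? w ∷ is
  ...     | yes u∈ = path-suffix is u∈ P
  ...     | no  u∉ = w ∷ is , e ∷ ls , ¬Any⇒All¬ _ u∉′ ∷ us
    where
    u∉′ : u ∉ˡ w ∷ is ++ [ v ]
    u∉′ u∈ with ∈-++⁻ (w ∷ is) u∈
    ... | inj₁ u∈is       = u∉ u∈is
    ... | inj₂ (here u≡v) = u≢v u≡v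

  first-edge : ∀ {u v} is → Path T u v is → ∃[ w ] w ∈ˡ is ++ [ v ] × Edge T u w
  first-edge []      (e ∷ _ , _) = _ , here refl , e
  first-edge (_ ∷ _) (e ∷ _ , _) = _ , here refl , e

  last-edge : ∀ {u v} is → Path T u v is → ∃[ w ] w ∈ˡ u ∷ is × Edge T w v
  last-edge []       (e ∷ _ , _) = _ , here refl , e
  last-edge (_ ∷ is) (_ ∷ es , _ ∷ us) with last-edge is (es , us)
  ... | w , w∈ , e = w , there w∈ , e

  Branching : Pred (Fin n) 0ℓ
  Branching v = ∃[ u ] ∃[ w ] u ≢ w × Edge T v u × Edge T v w

  module _ (edge-sym : Symmetric (Edge T)) where

    private
      Turn : List (Fin n) → Pred (Fin n) 0ℓ
      Turn xs v = ∃[ u ] ∃[ w ] (u ∈ˡ xs × w ∈ˡ xs) × u ≢ w × Edge T v u × Edge T v w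

    internal-turn : ∀ {u v x} is → Path T u v is → x ∈ˡ is → Turn (u ∷ is ++ [ v ]) x
    internal-turn {u} (x ∷ is) (e ∷ es , ps ∷ us) (here refl) with first-edge is (es , us)
    ... | w , w∈ , e′ =
      u , w , (here refl , there (there w∈)) , All.lookup ps (there w∈) , edge-sym e , e′
    internal-turn (_ ∷ is) (_ ∷ es , _ ∷ us) (there x∈) with internal-turn is (es , us) x∈
    ... | y , z , (y∈ , z∈) , rest = y , z , (there y∈ , there z∈) , rest

    internal⇒branching : ∀ {u v x} is → Path T u v is → x ∈ˡ is → Branching x
    internal⇒branching is P x∈ with internal-turn is P x∈
    ... | y , z , _ , rest = y , z , rest

    cycle-turn : ∀ {u v x} is → Path T u v is → is ≢ [] → Edge T v u →
                 x ∈ˡ u ∷ is ++ [ v ] → Turn (u ∷ is ++ [ v ]) x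
    cycle-turn [] _ ≢[] _ _ = contradiction refl ≢[]
    cycle-turn {u} {v} {x} is@(i ∷ is′) P@(e ∷ es , ps ∷ us) _ vu = go
      where
      v∈ : v ∈ˡ u ∷ is ++ [ v ]
      v∈ = there (∈-++⁺ʳ is (here refl))

      v≢i : v ≢ i
      v≢i v≡i = All.lookup (head us) (∈-++⁺ʳ is′ (here refl)) (sym v≡i)

      go : x ∈ˡ u ∷ is ++ [ v ] → Turn (u ∷ is ++ [ v ]) x
      go (here refl) = v , i , (v∈ , there (here refl)) , v≢i , edge-sym vu , e
      go (there x∈) with ∈-++⁻ is x∈
      ... | inj₁ x∈is = internal-turn is P x∈is
      ... | inj₂ (here refl) with last-edge is′ (es , us)
      ...   | w , w∈ , wv =
        u , w , (here refl , there w∈′) , All.lookup ps w∈′ , vu , edge-sym wv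
        where w∈′ = ∈-++⁺ˡ {ys = [ v ]} w∈

    -- A vertex of maximal rank on a cycle would have both of its cycle
    -- neighbours at most as high as itself.

    ranked⇒acyclic : (rank : Fin n → ℕ) →
      (∀ {x y z} → Edge T x y → Edge T x z → rank y ≤ rank x → rank z ≤ rank x → y ≡ z) →
      Acyclic T
    ranked⇒acyclic rank unique (u , v , is , P , ≢[] , vu) = clash (cycle-turn is P ≢[] vu top∈)
      where
      cycle = u ∷ is ++ [ v ]
      top   = argmax rank u (is ++ [ v ])

      top∈ : top ∈ˡ cycle
      top∈ = Sum.[ here , there ]′ (argmax-sel rank u (is ++ [ v ]))

      below : ∀ {x} → x ∈ˡ cycle → rank x ≤ rank top
      below (here refl) = f[⊥]≤f[argmax] {f = rank} u (is ++ [ v ])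
      below (there x∈)  = All.lookup (f[xs]≤f[argmax] {f = rank} u (is ++ [ v ])) x∈

      clash : ¬ Turn cycle top
      clash (y , z , (y∈ , z∈) , y≢z , ey , ez) = y≢z (unique ey ez (below y∈) (below z∈))

branching-disjoint⇒paths-disjoint : ∀ {T T′ : Sub n} →
  Symmetric (Edge T) → Symmetric (Edge T′) →
  (∀ v → Branching T v → ¬ Branching T′ v) →
  ∀ {u v} is js → Path T u v is → Path T′ u v js → ∀ {x} → ¬ (x ∈ˡ is × x ∈ˡ js)
branching-disjoint⇒paths-disjoint {T = T} {T′} s s′ apart is js P Q (x∈is , x∈js) =
  apart _ (internal⇒branching T s is P x∈is) (internal⇒branching T′ s′ js Q x∈js)

-- A tree given by parent pointers on names for its vertices; outside `Mem`
-- the pointers carry no meaning.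

record Pointers (N : Set) : Set₁ where
  field
    Mem    : Pred N 0ℓ
    mem?   : Decidable Mem
    parent : N → Maybe N

  Link : N → N → Set
  Link u v = Mem v × parent v ≡ just u

record IsTree {N : Set} (_≈_ : N → N → Set) (S : Pred N 0ℓ) (P : Pointers N) : Set where
  open Pointers P
  field
    rank        : N → ℕ
    root        : N
    orphan⇒root : ∀ v → Mem v → parent v ≡ nothing → v ≡ root
    parent-mem  : ∀ u v → Link u v → Mem u
    parent-rank : ∀ u v → Link u v → rank u < rank v
    parent-adj  : ∀ u v → Link u v → u ≈ v
    spans       : ∀ v → S v → Mem v
    branches    : ∀ v → Mem v → S v ⊎
      (∃[ u ] ∃[ w ] u ≢ w × (Link u v ⊎ Link v u) × (Link w v ⊎ Link v w))

record Compatible {N : Set} (S : Pred N 0ℓ) (P P′ : Pointers N) : Set where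
  open Pointers
  field
    meet         : ∀ v → Mem P v → Mem P′ v → S v
    no-co-parent : ∀ u v w → parent P v ≡ just u → parent P′ w ≡ just u → ⊥
    no-crossing  : ∀ u v → parent P v ≡ just u → parent P′ u ≡ just v → ⊥

module Realise {N : Set} (names : Fin n ↔ N) (_≟ᴺ_ : DecidableEquality N) where

  open Inverse names using () renaming
    (to to name; from to vertex; strictlyInverseˡ to name-vertex; strictlyInverseʳ to vertex-name)

  name-injective : ∀ {u v} → name u ≡ name v → u ≡ v
  name-injective {u} {v} eq = trans (sym (vertex-name u)) (trans (cong vertex eq) (vertex-name v))

  module Tree (P : Pointers N) where
    open Pointers P

    Joined : N → N → Set
    Joined u v = Link u v ⊎ Link v u

    link? : ∀ u v → Dec (Link u v)
    link? u v = mem? v ×-dec maybe-dec _≟ᴺ_ (parent v) (just u)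

    joined? : ∀ u v → Dec (Joined u v)
    joined? u v = link? u v ⊎-dec link? v u

    tree : Sub n
    tree = sub (separate (mem? ∘ name)) (tabulate λ u → separate (joined? (name u) ∘ name))

    private
      lookup-nbrs : ∀ u → lookup (nbrs tree) u ≡ separate (joined? (name u) ∘ name)
      lookup-nbrs = lookup∘tabulate _

    edge⁺ : ∀ {u v} → Joined (name u) (name v) → Edge tree u v
    edge⁺ {u} {v} j = subst (v ∈_) (sym (lookup-nbrs u)) (∈-separate⁺ (joined? (name u) ∘ name) j)

    edge⁻ : ∀ {u v} → Edge tree u v → Joined (name u) (name v)
    edge⁻ {u} {v} e = ∈-separate⁻ (joined? (name u) ∘ name) (subst (v ∈_) (lookup-nbrs u) e)

    vert⁺ : ∀ {v} → Mem (name v) → v ∈ verts tree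
    vert⁺ = ∈-separate⁺ (mem? ∘ name)

    vert⁻ : ∀ {v} → v ∈ verts tree → Mem (name v)
    vert⁻ = ∈-separate⁻ (mem? ∘ name)

    edge-sym : Symmetric (Edge tree)
    edge-sym e = edge⁺ (Sum.swap (edge⁻ e))

    private
      joined⇒edge : ∀ {u v} → Joined u v → Edge tree (vertex u) (vertex v)
      joined⇒edge {u} {v} j =
        edge⁺ (subst₂ Joined (sym (name-vertex u)) (sym (name-vertex v)) j)

    branching⇒parent : ∀ v → Branching tree v → ∃[ w ] parent w ≡ just (name v)
    branching⇒parent v (u , w , u≢w , e , e′) with edge⁻ e | edge⁻ e′
    ... | inj₁ (_ , pu)  | _              = name u , pu
    ... | inj₂ _         | inj₁ (_ , pw)  = name w , pw
    ... | inj₂ (_ , pv)  | inj₂ (_ , pv′) =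
      contradiction (name-injective (just-injective (trans (sym pv) pv′))) u≢w

    module _ {_≈_ : N → N → Set} {S : Pred N 0ℓ} (isTree : IsTree _≈_ S P) where
      open IsTree isTree

      private
        climb : ∀ v → Mem v → Acc _<_ (rank v) → Star Joined v root
        climb v v∈ (acc rs) with parent v in eq
        ... | nothing = subst (Star Joined v) (orphan⇒root v v∈ eq) stay
        ... | just u  =
          inj₂ (v∈ , eq) ◅ climb u (parent-mem u v (v∈ , eq)) (rs (parent-rank u v (v∈ , eq)))

        walk : ∀ u v → u ∈ verts tree → v ∈ verts tree → Star (Edge tree) u v
        walk u v u∈ v∈ = subst₂ (Star (Edge tree)) (vertex-name u) (vertex-name v)
          (gmap vertex joined⇒edge (up u u∈ ◅◅ reverse Sum.swap (up v v∈)))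
          where
          up : ∀ w → w ∈ verts tree → Star Joined (name w) root
          up w w∈ = climb (name w) (vert⁻ w∈) (<-wellFounded _)

        lower-unique : ∀ {x y z} → Edge tree x y → Edge tree x z →
          rank (name y) ≤ rank (name x) → rank (name z) ≤ rank (name x) → y ≡ z
        lower-unique e e′ y≤x z≤x with edge⁻ e | edge⁻ e′
        ... | inj₁ l        | _              = contradiction y≤x (<⇒≱ (parent-rank _ _ l))
        ... | inj₂ _        | inj₁ l         = contradiction z≤x (<⇒≱ (parent-rank _ _ l))
        ... | inj₂ (_ , py) | inj₂ (_ , pz)  = name-injective (just-injective (trans (sym py) pz))

      isSteinerTree : (G : Graph n) (S′ : Subset n) →
        (∀ {u v} → name u ≈ name v → Graph._~_ G u v) →
        (∀ {v} → S (name v) → v ∈ S′) → (∀ {v} → v ∈ S′ → S (name v)) →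
        IsSteinerTree G S′ tree
      isSteinerTree G S′ adj S⁺ S⁻ = record
        { isSubgraph = record
          { edge-sym  = λ _ _ → edge-sym
          ; edge-vert = λ u v e → vert⁺ (tail-mem (edge⁻ e))
          ; edge-adj  = λ u v e → tail-adj (edge⁻ e)
          }
        ; connected = λ u v u∈ v∈ → walk⇒path tree (walk u v u∈ v∈)
        ; acyclic   = ranked⇒acyclic tree edge-sym (rank ∘ name) lower-unique
        ; spans     = λ v∈ → vert⁺ (spans _ (S⁻ v∈))
        ; leaves    = λ v l → leaf v l (branches (name v) (vert⁻ (proj₁ l)))
        }
        where
        tail-mem : ∀ {u v} → Joined u v → Mem u
        tail-mem (inj₁ l)        = parent-mem _ _ l
        tail-mem (inj₂ (u∈ , _)) = u∈

        tail-adj : ∀ {u v} → Joined (name u) (name v) → Graph._~_ G u v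
        tail-adj (inj₁ l) = adj (parent-adj _ _ l)
        tail-adj (inj₂ l) = Graph.~-sym G (adj (parent-adj _ _ l))

        vertex-injective : ∀ {x y} → vertex x ≡ vertex y → x ≡ y
        vertex-injective {x} {y} eq =
          trans (sym (name-vertex x)) (trans (cong name eq) (name-vertex y))

        nbr : ∀ {v x} → Joined x (name v) → vertex x ∈ lookup (nbrs tree) v
        nbr {v} j = subst (λ w → Edge tree w _) (vertex-name v) (joined⇒edge (Sum.swap j))

        leaf : ∀ v → IsLeaf tree v → S (name v) ⊎ (∃[ x ] ∃[ y ] x ≢ y ×
               Joined x (name v) × Joined y (name v)) → v ∈ S′
        leaf v _ (inj₁ s) = S⁺ s
        leaf v (_ , deg≡1) (inj₂ (x , y , x≢y , jx , jy)) =
          contradiction (subst (2 ≤_) deg≡1 (2≤∣p∣ (nbr jx) (nbr jy) (x≢y ∘ vertex-injective)))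
                        λ { (s≤s ()) }

  open Tree using (tree; edge⁻; vert⁺; vert⁻; edge-sym; branching⇒parent)

  compatible⇒independent : ∀ {S : Pred N 0ℓ} (P P′ : Pointers N) → Compatible S P P′ →
    (∀ v → S v → Pointers.Mem P v) → (∀ v → S v → Pointers.Mem P′ v) →
    (S′ : Subset n) → (∀ {v} → S (name v) → v ∈ S′) → (∀ {v} → v ∈ S′ → S (name v)) →
    Independent S′ (tree P) (tree P′)
  compatible⇒independent P P′ c sp sp′ S′ S⁺ S⁻ = record
    { edge-disjoint  = λ u v (e , e′) → edges (edge⁻ P e) (edge⁻ P′ e′)
    ; verts-meet     = ⊆-antisym
        (λ v∈ → let v∈P , v∈P′ = x∈p∩q⁻ _ _ v∈ in S⁺ (meet _ (vert⁻ P v∈P) (vert⁻ P′ v∈P′)))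
        (λ v∈ → x∈p∩q⁺ (vert⁺ P (sp _ (S⁻ v∈)) , vert⁺ P′ (sp′ _ (S⁻ v∈))))
    ; paths-disjoint = λ x₁ x₂ _ _ is js Q Q′ → branching-disjoint⇒paths-disjoint {T = tree P} {tree P′}
        (edge-sym P) (edge-sym P′) (λ v b b′ → no-co-parent _ _ _
          (proj₂ (branching⇒parent P v b)) (proj₂ (branching⇒parent P′ v b′))) is js Q Q′
    }
    where
    open Compatible c
    edges : ∀ {u v} → Tree.Joined P u v → ¬ Tree.Joined P′ u v
    edges (inj₁ (_ , p)) (inj₁ (_ , q)) = no-co-parent _ _ _ p q
    edges (inj₁ (_ , p)) (inj₂ (_ , q)) = no-crossing _ _ p q
    edges (inj₂ (_ , p)) (inj₁ (_ , q)) = no-crossing _ _ p q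
    edges (inj₂ (_ , p)) (inj₂ (_ , q)) = no-co-parent _ _ _ p q

-- xs and ys name the vertices in S, xo and yo those outside.

Node : (a p b q : ℕ) → Set
Node a p b q = (Fin a ⊎ Fin p) ⊎ (Fin b ⊎ Fin q)

pattern xs u = inj₁ (inj₁ u)
pattern xo u = inj₁ (inj₂ u)
pattern ys v = inj₂ (inj₁ v)
pattern yo v = inj₂ (inj₂ v)

module _ {a p b q : ℕ} where

  _≟ᴺ_ : DecidableEquality (Node a p b q)
  _≟ᴺ_ = sum-dec (sum-dec _≟_ _≟_) (sum-dec _≟_ _≟_)

  names : Fin ((a + p) + (b + q)) ↔ Node a p b q
  names = (+↔⊎ ⊎-↔ +↔⊎) ↔-∘ +↔⊎

  name : Fin ((a + p) + (b + q)) → Node a p b q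
  name = Inverse.to names

  private
    core : Node a p b q → Bool
    core (xs _) = true
    core (xo _) = false
    core (ys _) = true
    core (yo _) = false

    <ᵇ-splitAt : ∀ a {p} (j : Fin (a + p)) →
                 (toℕ j <ᵇ a) ≡ Sum.[ (λ _ → true) , (λ _ → false) ]′ (splitAt a j)
    <ᵇ-splitAt zero    j       = refl
    <ᵇ-splitAt (suc a) zero    = refl
    <ᵇ-splitAt (suc a) (suc j) with splitAt a j | <ᵇ-splitAt a j
    ... | inj₁ _ | eq = eq
    ... | inj₂ _ | eq = eq

    member-core : ∀ v → Sum.[ (λ j → toℕ j <ᵇ a) , (λ j → toℕ j <ᵇ b) ]′ (splitAt (a + p) v) ≡
                        core (name v)
    member-core v with splitAt (a + p) v
    ... | inj₁ j with splitAt a j | <ᵇ-splitAt a j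
    ...   | inj₁ _ | eq = eq
    ...   | inj₂ _ | eq = eq
    member-core v | inj₂ j with splitAt b j | <ᵇ-splitAt b j
    ...   | inj₁ _ | eq = eq
    ...   | inj₂ _ | eq = eq

  Core : Pred (Node a p b q) 0ℓ
  Core = T ∘ core

  core⁺ : ∀ {v} → Core (name v) → v ∈ initial (a + p) (b + q) a b
  core⁺ {v} c = lookup⇒[]= v _
    (trans (lookup∘tabulate _ v) (trans (member-core v) (Equivalence.to T-≡ c)))

  core⁻ : ∀ {v} → v ∈ initial (a + p) (b + q) a b → Core (name v)
  core⁻ {v} v∈ = Equivalence.from T-≡
    (trans (sym (member-core v)) (trans (sym (lookup∘tabulate _ v)) ([]=⇒lookup v∈)))

  opposite⇒adjacent : ∀ {u v} → Opposite (name u) (name v) → Graph._~_ (K (a + p) (b + q)) u v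
  opposite⇒adjacent {u} {v} with splitAt (a + p) u | splitAt (a + p) v
  ... | inj₁ _ | inj₁ _ = λ ()
  ... | inj₁ _ | inj₂ _ = λ _ → tt
  ... | inj₂ _ | inj₁ _ = λ _ → tt
  ... | inj₂ _ | inj₂ _ = λ ()

-- The trees come in three kinds: p double stars, each centred at an edge
-- joining two vertices outside S; β mixed trees, each with one vertex
-- outside S; and γ inner trees, with none.  `w` picks the vertices of Y
-- outside S, and `h` and `g` the vertices of S that are not leaves.  In a
-- mixed or inner tree the leaf `ys v` hangs from `h _ (py v)`, and in an
-- inner tree the leaf `xs u` hangs from `g _ (px u)`: the opposite
-- conventions for `px` and `py` on hubs keep edges between a hub of one tree
-- and a hub of another from being used twice.

record Hubs (a p b q β γ : ℕ) : Set where
  field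
    w     : Fin p ⊎ Fin β → Fin q
    w-inj : ∀ {s t} → w s ≡ w t → s ≡ t
    h     : Fin β ⊎ Fin γ → Bool → Fin a
    h-inj : ∀ {s t δ ε} → h s δ ≡ h t ε → s ≡ t
    g     : Fin γ → Bool → Fin b
    g-inj : ∀ {s t δ ε} → g s δ ≡ g t ε → s ≡ t
    px    : Fin a → Bool
    py    : Fin b → Bool
    px-h  : Fin γ → ∀ s ε → px (h s ε) ≡ not ε
    py-g  : ∀ s ε → py (g s ε) ≡ ε

module Family {a p b q β γ : ℕ} (H : Hubs a p b q β γ)
  {x₀ x₁ : Fin a} (x₀≢x₁ : x₀ ≢ x₁) (y₀ : Fin b) where
  open Hubs H

  N : Set
  N = Node a p b q

  Index : Set
  Index = Fin p ⊎ (Fin β ⊎ Fin γ)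

  pattern star t  = inj₁ t
  pattern mixed j = inj₂ (inj₁ j)
  pattern inner j = inj₂ (inj₂ j)

  -- In the inner tree j the hubs form the path
  -- h true – g true – h false – g false, rooted at h false.

  y-side : Fin β ⊎ Fin γ → Fin b → Bool
  y-side (inj₁ j) v = py v
  y-side (inj₂ j) v = if does (v ≟ g j true) then false else py v

  x-side : Fin γ → Fin a → Bool
  x-side j u = if does (u ≟ h (inj₂ j) true) then true else px u

  parent : Index → N → Maybe N
  parent (star t)  (xs _) = just (yo (w (inj₁ t)))
  parent (star t)  (xo _) = nothing
  parent (star t)  (ys _) = just (xo t)
  parent (star t)  (yo _) = just (xo t)
  parent (inj₂ s)  (xo _) = nothing
  parent (inj₂ s)  (ys v) = just (xs (h s (y-side s v)))
  parent (inj₂ s)  (yo _) = nothing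
  parent (mixed j) (xs _) = just (yo (w (inj₂ j)))
  parent (inner j) (xs u) =
    if does (u ≟ h (inj₂ j) false) then nothing else just (ys (g j (x-side j u)))

  rank : Index → N → ℕ
  rank (star t)  (xs _) = 2
  rank (star t)  (xo _) = 0
  rank (star t)  (ys _) = 1
  rank (star t)  (yo _) = 1
  rank (mixed j) (xs _) = 1
  rank (mixed j) (xo _) = 0
  rank (mixed j) (ys _) = 2
  rank (mixed j) (yo _) = 0
  rank (inner j) (xs u) = if does (u ≟ h (inj₂ j) false) then 0 else 2
  rank (inner j) (xo _) = 0
  rank (inner j) (ys v) = if y-side (inj₂ j) v then 3 else 1
  rank (inner j) (yo _) = 0

  root : Index → N
  root (star t)  = xo t
  root (mixed j) = yo (w (inj₂ j))
  root (inner j) = xs (h (inj₂ j) false)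

  Mem : Index → Pred N 0ℓ
  Mem i         (xs _) = ⊤
  Mem i         (ys _) = ⊤
  Mem (star t)  (xo u) = u ≡ t
  Mem (inj₂ _)  (xo _) = ⊥
  Mem (star t)  (yo v) = v ≡ w (inj₁ t)
  Mem (mixed j) (yo v) = v ≡ w (inj₂ j)
  Mem (inner j) (yo _) = ⊥

  mem? : ∀ i → Decidable (Mem i)
  mem? i         (xs _) = yes tt
  mem? i         (ys _) = yes tt
  mem? (star t)  (xo u) = u ≟ t
  mem? (inj₂ _)  (xo _) = no λ ()
  mem? (star t)  (yo v) = v ≟ w (inj₁ t)
  mem? (mixed j) (yo v) = v ≟ w (inj₂ j)
  mem? (inner j) (yo _) = no λ ()

  pointers : Index → Pointers N
  pointers i = record { Mem = Mem i ; mem? = mem? i ; parent = parent i }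

  Hub : Index → Pred N 0ℓ
  Hub i         (xo u) = Mem i (xo u)
  Hub i         (yo v) = Mem i (yo v)
  Hub (star _)  (xs _) = ⊥
  Hub (inj₂ s)  (xs u) = ∃[ ε ] u ≡ h s ε
  Hub (star _)  (ys _) = ⊥
  Hub (mixed _) (ys _) = ⊥
  Hub (inner j) (ys v) = ∃[ ε ] v ≡ g j ε

  parent⇒hub : ∀ i {u} v → parent i v ≡ just u → Hub i u
  parent⇒hub (star t)         (xs _) refl = refl
  parent⇒hub (star t)         (ys _) refl = refl
  parent⇒hub (star t)         (yo _) refl = refl
  parent⇒hub (mixed j)        (xs _) refl = refl
  parent⇒hub (mixed j)        (ys _) refl = _ , refl
  parent⇒hub (inner j)        (ys _) refl = _ , refl
  parent⇒hub (inner j)        (xs u) eq with u ≟ h (inj₂ j) false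
  parent⇒hub (inner j)        (xs u) refl | no _ = _ , refl

  hub-unique : ∀ i i′ u → Hub i u → Hub i′ u → i ≡ i′
  hub-unique (inj₂ s)  (inj₂ s′)  (xs u) (_ , eq) (_ , eq′) = cong inj₂ (h-inj (trans (sym eq) eq′))
  hub-unique (star t)  (star t′)  (xo u) eq eq′ = cong inj₁ (trans (sym eq) eq′)
  hub-unique (star _)  (inj₂ _)   (xo u) _ ()
  hub-unique (inj₂ _)  (star _)   (xo u) () _
  hub-unique (inner j) (inner j′) (ys v) (_ , eq) (_ , eq′) =
    cong inner (g-inj (trans (sym eq) eq′))
  hub-unique (star t)  (star t′)  (yo v) eq eq′ =
    cong inj₁ (inj₁-injective (w-inj (trans (sym eq) eq′)))
  hub-unique (mixed j) (mixed j′) (yo v) eq eq′ =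
    cong mixed (inj₂-injective (w-inj (trans (sym eq) eq′)))
  hub-unique (star t)  (mixed j)  (yo v) eq eq′ with () ← w-inj (trans (sym eq) eq′)
  hub-unique (mixed j) (star t)   (yo v) eq eq′ with () ← w-inj (trans (sym eq) eq′)

  no-crossing-inner : ∀ s j {u v} → s ≢ inj₂ j → u ≡ h s (y-side s v) →
                      parent (inner j) (xs u) ≡ just (ys v) → ⊥
  no-crossing-inner s j {u} {v} s≢j u≡ eq with u ≟ h (inj₂ j) false
  no-crossing-inner s j {u} {v} s≢j u≡ refl | no _ =
    not-¬ {y-side s v} refl (trans (side-y s s≢j) (trans (py-g j _) (trans side-x
      (trans (cong px u≡) (px-h j s _)))))
    where
    side-x : x-side j u ≡ px u
    side-x with u ≟ h (inj₂ j) true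
    ... | yes eq = contradiction (h-inj (trans (sym u≡) eq)) s≢j
    ... | no  _  = refl

    side-y : ∀ s → s ≢ inj₂ j → y-side s (g j (x-side j u)) ≡ py (g j (x-side j u))
    side-y (inj₁ _)  _   = refl
    side-y (inj₂ j′) ≢j with g j (x-side j u) ≟ g j′ true
    ... | yes eq = contradiction (cong inj₂ (sym (g-inj eq))) ≢j
    ... | no  _  = refl

  no-crossing : ∀ i i′ u v → i ≢ i′ → parent i v ≡ just u → parent i′ u ≡ just v → ⊥
  no-crossing (star _)  (star _)  _ (xs _) _ refl ()
  no-crossing (star _)  (star _)  _ (ys _) _ refl ()
  no-crossing (star _)  (star _)  _ (yo _) _ refl ()
  no-crossing (star _)  (inj₂ _)  _ (xs _) _ refl ()
  no-crossing (star _)  (inj₂ _)  _ (ys _) _ refl ()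
  no-crossing (star _)  (inj₂ _)  _ (yo _) _ refl ()
  no-crossing (mixed _) (star _)  _ (xs _) _ refl ()
  no-crossing (mixed _) (inj₂ _)  _ (xs _) _ refl ()
  no-crossing (inj₂ _)  (star _)  _ (ys _) _ refl ()
  no-crossing (inj₂ _)  (mixed _) _ (ys _) _ refl ()
  no-crossing (inj₂ s)  (inner j) _ (ys v) ≢ refl eq = no-crossing-inner s j (≢ ∘ cong inj₂) refl eq
  no-crossing (inner j) (star _)  (ys _) (xs _) ≢ _ ()
  no-crossing (inner j) (inj₂ s)  (ys v) (xs u) ≢ eq refl =
    no-crossing-inner s j (≢ ∘ sym ∘ cong inj₂) refl eq
  no-crossing (inner j) i′ (xs _) (xs u) ≢ eq _ with u ≟ h (inj₂ j) false
  no-crossing (inner j) i′ (xs _) (xs u) ≢ () _ | yes _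
  no-crossing (inner j) i′ (xs _) (xs u) ≢ () _ | no _
  no-crossing (inner j) i′ (xo _) (xs u) ≢ eq _ = parent⇒hub (inner j) (xs u) eq
  no-crossing (inner j) i′ (yo _) (xs u) ≢ eq _ = parent⇒hub (inner j) (xs u) eq

  orphan⇒root : ∀ i v → Mem i v → parent i v ≡ nothing → v ≡ root i
  orphan⇒root (star t)  (xo u) refl _ = refl
  orphan⇒root (star t)  (ys v) _ ()
  orphan⇒root (star t)  (yo v) _ ()
  orphan⇒root (mixed j) (xs u) _ ()
  orphan⇒root (inj₂ s)  (ys v) _ ()
  orphan⇒root (mixed j) (yo v) refl _ = refl
  orphan⇒root (inner j) (xs u) _ eq with u ≟ h (inj₂ j) false
  ... | yes refl = refl

  hub-mem : ∀ i u → Hub i u → Mem i u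
  hub-mem i (xs _) _ = tt
  hub-mem i (xo _) m = m
  hub-mem i (ys _) _ = tt
  hub-mem i (yo _) m = m

  parent-rank : ∀ i u v → Mem i v × parent i v ≡ just u → rank i u < rank i v
  parent-rank (star t)  _ (xs _) (_ , refl) = s≤s (s≤s z≤n)
  parent-rank (star t)  _ (ys _) (_ , refl) = s≤s z≤n
  parent-rank (star t)  _ (yo _) (_ , refl) = s≤s z≤n
  parent-rank (mixed j) _ (xs _) (_ , refl) = s≤s z≤n
  parent-rank (mixed j) _ (ys _) (_ , refl) = s≤s (s≤s z≤n)
  parent-rank (inner j) _ (ys v) (_ , refl) with y-side (inj₂ j) v
  ... | true  with h (inj₂ j) true ≟ h (inj₂ j) false
  ...   | yes _ = s≤s z≤n
  ...   | no  _ = s≤s (s≤s (s≤s z≤n))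
  parent-rank (inner j) _ (ys v) (_ , refl) | false with h (inj₂ j) false ≟ h (inj₂ j) false
  ... | yes _ = s≤s z≤n
  ... | no ¬r = contradiction refl ¬r
  parent-rank (inner j) _ (xs u) (_ , eq) with u ≟ h (inj₂ j) false
  parent-rank (inner j) _ (xs u) (_ , refl) | no _ = g-low (x-side j u)
    where
    g-low : ∀ ε → rank (inner j) (ys (g j ε)) < 2
    g-low ε with g j ε ≟ g j true
    ... | yes _ = s≤s (s≤s z≤n)
    g-low true  | no ¬r = contradiction refl ¬r
    g-low false | no _ rewrite py-g j false = s≤s (s≤s z≤n)

  parent-adj : ∀ i u v → Mem i v × parent i v ≡ just u → Opposite u v
  parent-adj (star t)  _ (xs _) (_ , refl) = tt
  parent-adj (star t)  _ (ys _) (_ , refl) = tt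
  parent-adj (star t)  _ (yo _) (_ , refl) = tt
  parent-adj (mixed j) _ (xs _) (_ , refl) = tt
  parent-adj (mixed j) _ (ys _) (_ , refl) = tt
  parent-adj (inner j) _ (ys v) (_ , refl) = tt
  parent-adj (inner j) _ (xs u) (_ , eq) with u ≟ h (inj₂ j) false
  parent-adj (inner j) _ (xs u) (_ , refl) | no _ = tt

  branches : ∀ i v → Mem i v → Core v ⊎
    (let open Pointers (pointers i) in
     ∃[ u ] ∃[ w ] u ≢ w × (Link u v ⊎ Link v u) × (Link w v ⊎ Link v w))
  branches i         (xs _) _    = inj₁ tt
  branches i         (ys _) _    = inj₁ tt
  branches (star t)  (xo u) refl = inj₂ (yo (w (inj₁ t)) , ys y₀ , (λ ()) ,
    inj₂ (refl , refl) , inj₂ (tt , refl))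
  branches (star t)  (yo v) refl = inj₂ (xo t , xs x₀ , (λ ()) ,
    inj₁ (refl , refl) , inj₂ (tt , refl))
  branches (mixed j) (yo v) refl = inj₂ (xs x₀ , xs x₁ , (λ { refl → x₀≢x₁ refl }) ,
    inj₂ (tt , refl) , inj₂ (tt , refl))

  core⇒mem : ∀ i v → Core v → Mem i v
  core⇒mem i (xs _) _ = tt
  core⇒mem i (ys _) _ = tt

  isTree : ∀ i → IsTree Opposite Core (pointers i)
  isTree i = record
    { rank        = rank i
    ; root        = root i
    ; orphan⇒root = orphan⇒root i
    ; parent-mem  = λ u v (_ , eq) → hub-mem i u (parent⇒hub i v eq)
    ; parent-rank = parent-rank i
    ; parent-adj  = parent-adj i
    ; spans       = core⇒mem i
    ; branches    = branches i
    }

  compatible : ∀ i i′ → i ≢ i′ → Compatible Core (pointers i) (pointers i′)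
  compatible i i′ i≢i′ = record
    { meet         = meet
    ; no-co-parent = λ u v w eq eq′ →
        i≢i′ (hub-unique i i′ u (parent⇒hub i v eq) (parent⇒hub i′ w eq′))
    ; no-crossing  = λ u v → no-crossing i i′ u v i≢i′
    }
    where
    meet : ∀ v → Mem i v → Mem i′ v → Core v
    meet (xs _) _ _  = tt
    meet (ys _) _ _  = tt
    meet (xo u) m m′ = contradiction (hub-unique i i′ (xo u) m m′) i≢i′
    meet (yo v) m m′ = contradiction (hub-unique i i′ (yo v) m m′) i≢i′

  open Realise (names {a} {p} {b} {q}) _≟ᴺ_ using (module Tree; compatible⇒independent)

  indices : Fin (p + (β + γ)) ↔ Index
  indices = (↔-id _ ⊎-↔ +↔⊎) ↔-∘ +↔⊎

  index : Fin (p + (β + γ)) → Index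
  index = Inverse.to indices

  S : Subset ((a + p) + (b + q))
  S = initial (a + p) (b + q) a b

  hasCIFamily : HasCIFamily (K (a + p) (b + q)) S (p + (β + γ))
  hasCIFamily = (λ t → Tree.tree (pointers (index t))) , record
    { steiner     = λ t → Tree.isSteinerTree (pointers (index t)) (isTree (index t)) _ S
        (λ {u} {v} → opposite⇒adjacent {a} {p} {b} {q} {u} {v}) core⁺ core⁻
    ; independent = λ s t s<t → compatible⇒independent (pointers (index s)) (pointers (index t))
        (compatible (index s) (index t) (<⇒≢ s<t ∘ index-injective))
        (core⇒mem (index s)) (core⇒mem (index t)) S core⁺ core⁻
    }
    where
    index-injective : ∀ {s t} → index s ≡ index t → s ≡ t
    index-injective {s} {t} eq = trans (sym (Inverse.strictlyInverseʳ indices s))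
      (trans (cong (Inverse.from indices) eq) (Inverse.strictlyInverseʳ indices t))

  2≤∣S∣ : 2 ≤ ∣ S ∣
  2≤∣S∣ = 2≤∣p∣ (vertex∈ (xs x₀) tt) (vertex∈ (ys y₀) tt) distinct
    where
    open Inverse (names {a} {p} {b} {q})
    vertex∈ : ∀ v → Core v → from v ∈ S
    vertex∈ v c = core⁺ (subst Core (sym (strictlyInverseˡ v)) c)
    distinct : from (xs x₀) ≢ from (ys y₀)
    distinct eq with () ← trans (sym (strictlyInverseˡ (xs x₀))) (trans (cong to eq) (strictlyInverseˡ (ys y₀)))

  κ*-bound : p + (β + γ) ≤ κ* (K (a + p) (b + q)) S
  κ*-bound = proj₂ (κ*-isMaximum (K (a + p) (b + q)) S 2≤∣S∣) _ hasCIFamily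

odd : ℕ → Bool
odd zero    = false
odd (suc n) = not (odd n)

odd-2*+ : ∀ m n → odd (2 * m + n) ≡ odd n
odd-2*+ zero    n = refl
odd-2*+ (suc m) n rewrite +-suc m (m + 0) =
  trans (not-involutive (odd (2 * m + n))) (odd-2*+ m n)

module _ {m n : ℕ} (m*2≤n : m * 2 ≤ n) where

  bit : Bool → Fin 2
  bit false = zero
  bit true  = suc zero

  pair : Fin m → Bool → Fin n
  pair j ε = inject≤ (combine j (bit ε)) m*2≤n

  pair-injective : ∀ {j k δ ε} → pair j δ ≡ pair k ε → j ≡ k
  pair-injective eq = combine-injectiveˡ _ _ _ _ (inject≤-injective m*2≤n m*2≤n _ _ eq)

  odd-pair : ∀ j ε → odd (toℕ (pair j ε)) ≡ ε
  odd-pair j ε = begin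
    odd (toℕ (pair j ε))              ≡⟨ cong odd (toℕ-inject≤ (combine j (bit ε)) m*2≤n) ⟩
    odd (toℕ (combine j (bit ε)))     ≡⟨ cong odd (toℕ-combine j (bit ε)) ⟩
    odd (2 * toℕ j + toℕ (bit ε))     ≡⟨ odd-2*+ (toℕ j) _ ⟩
    odd (toℕ (bit ε))                 ≡⟨ odd-bit ε ⟩
    ε                                 ∎
    where
    open ≡-Reasoning
    odd-bit : ∀ ε → odd (toℕ (bit ε)) ≡ ε
    odd-bit false = refl
    odd-bit true  = refl

module _ {p β r : ℕ} (β≤r : β ≤ r) where

  wing : Fin p ⊎ Fin β → Fin (p + r)
  wing s = join p r (Sum.map₂ (λ j → inject≤ j β≤r) s)

  wing-injective : ∀ {s t} → wing s ≡ wing t → s ≡ t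
  wing-injective {s} {t} eq = widen-injective s t
    (trans (sym (splitAt-join p r _)) (trans (cong (splitAt p) eq) (splitAt-join p r _)))
    where
    widen-injective : ∀ (s t : Fin p ⊎ Fin β) →
      Sum.map₂ (λ j → inject≤ j β≤r) s ≡ Sum.map₂ (λ j → inject≤ j β≤r) t → s ≡ t
    widen-injective (inj₁ _) (inj₁ _) refl = refl
    widen-injective (inj₂ _) (inj₂ _) eq   =
      cong inj₂ (inject≤-injective β≤r β≤r _ _ (inj₂-injective eq))

single-hubs : ∀ {a p b r β} → β ≤ a → β ≤ r → Hubs a p b (p + r) β 0
single-hubs β≤a β≤r = record
  { w     = wing β≤r
  ; w-inj = wing-injective β≤r
  ; h     = λ { (inj₁ j) _ → inject≤ j β≤a }
  ; h-inj = λ { {inj₁ _} {inj₁ _} eq → cong inj₁ (inject≤-injective β≤a β≤a _ _ eq) }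
  ; g     = λ ()
  ; g-inj = λ { {()} }
  ; px    = λ _ → false
  ; py    = λ _ → false
  ; px-h  = λ ()
  ; py-g  = λ ()
  }

paired-hubs : ∀ {a p b r γ} → (r + γ) * 2 ≤ a → γ * 2 ≤ b → Hubs a p b (p + r) r γ
paired-hubs {r = r} {γ} ≤a ≤b = record
  { w     = wing ≤-refl
  ; w-inj = wing-injective ≤-refl
  ; h     = λ s → pair ≤a (join r γ s)
  ; h-inj = λ {s} {t} eq → trans (sym (splitAt-join r γ s))
      (trans (cong (splitAt r) (pair-injective ≤a eq)) (splitAt-join r γ t))
  ; g     = pair ≤b
  ; g-inj = pair-injective ≤b
  ; px    = not ∘ odd ∘ toℕ
  ; py    = odd ∘ toℕ
  ; px-h  = λ _ s ε → cong not (odd-pair ≤a (join r γ s) ε)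
  ; py-g  = odd-pair ≤b
  }

two-elements : ∀ {a} → 2 ≤ a → ∃[ x ] ∃[ y ] _≢_ {A = Fin a} x y
two-elements (s≤s (s≤s _)) = zero , suc zero , λ ()

κ*-lower-bound : ∀ {m₁ m₂ a p b q β γ} → a + p ≡ m₁ → b + q ≡ m₂ → 1 ≤ b → 2 ≤ a →
  Hubs a p b q β γ → κ* (K m₁ m₂) (initial m₁ m₂ a b) ≥ p + (β + γ)
κ*-lower-bound refl refl 1≤b 2≤a H =
  Family.κ*-bound H (proj₂ (proj₂ (two-elements 2≤a))) (fromℕ< 1≤b)

⌊n/2⌋*2≤n : ∀ n → ⌊ n /2⌋ * 2 ≤ n
⌊n/2⌋*2≤n n = begin
  ⌊ n /2⌋ * 2            ≡⟨ solve 1 (λ x → x :* con 2 := x :+ x) refl ⌊ n /2⌋ ⟩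
  ⌊ n /2⌋ + ⌊ n /2⌋      ≤⟨ +-monoʳ-≤ ⌊ n /2⌋ (⌊n/2⌋≤⌈n/2⌉ n) ⟩
  ⌊ n /2⌋ + ⌈ n /2⌉      ≡⟨ ⌊n/2⌋+⌈n/2⌉≡n n ⟩
  n                      ∎
  where open ≤-Reasoning

m+m≤n⇒m≤⌊n/2⌋ : ∀ {m n} → m + m ≤ n → m ≤ ⌊ n /2⌋
m+m≤n⇒m≤⌊n/2⌋ {m} m+m≤n = ≤-trans (≤-reflexive (n≡⌊n+n/2⌋ m)) (⌊n/2⌋-mono m+m≤n)

module Bounds {a p b r κS : ℕ} (m₁≤m₂ : a + p ≤ b + (p + r))
  (large : a + b ≥ (b + (p + r) ∸ (a + p)) + 3)
  (from-hubs : ∀ {β γ} → 2 ≤ a → Hubs a p b (p + r) β γ → κS ≥ p + (β + γ)) where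

  D : ℕ
  D = (a + p) + (a + b) ∸ (b + (p + r))

  private
    r+3≤a+a : r + 3 ≤ a + a
    r+3≤a+a = +-cancelˡ-≤ (b + p) _ _ (begin
      (b + p) + (r + 3)
        ≡⟨ solve 3 (λ b p r → (b :+ p) :+ (r :+ con 3) := (b :+ (p :+ r)) :+ con 3) refl b p r ⟩
      (b + (p + r)) + 3
        ≤⟨ +-monoˡ-≤ 3 (m≤n+m∸n (b + (p + r)) (a + p)) ⟩
      (a + p) + (b + (p + r) ∸ (a + p)) + 3
        ≡⟨ +-assoc (a + p) _ 3 ⟩
      (a + p) + ((b + (p + r) ∸ (a + p)) + 3)
        ≤⟨ +-monoʳ-≤ (a + p) large ⟩
      (a + p) + (a + b)
        ≡⟨ solve 3 (λ a p b → (a :+ p) :+ (a :+ b) := (b :+ p) :+ (a :+ a)) refl a p b ⟩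
      (b + p) + (a + a) ∎)
      where open ≤-Reasoning

    2≤a : 2 ≤ a
    2≤a with 2 ≤? a
    ... | yes 2≤a = 2≤a
    ... | no  2≰a = contradiction (≤-trans (m≤n+m 3 r) r+3≤a+a)
      (<⇒≱ (s≤s (+-mono-≤ (≤-pred (≰⇒> 2≰a)) (≤-pred (≰⇒> 2≰a)))))

    a+a≡r+D : a + a ≡ r + D
    a+a≡r+D = begin
      a + a             ≡⟨ m+[n∸m]≡n r≤a+a ⟨
      r + (a + a ∸ r)   ≡⟨ cong (r +_) ([m+n]∸[m+o]≡n∸o (b + p) (a + a) r) ⟨
      r + ((b + p) + (a + a) ∸ ((b + p) + r))
        ≡⟨ cong (r +_) (cong₂ _∸_
             (solve 3 (λ a p b → (b :+ p) :+ (a :+ a) := (a :+ p) :+ (a :+ b)) refl a p b)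
             (+-assoc b p r)) ⟩
      r + D             ∎
      where
      open ≡-Reasoning
      r≤a+a = ≤-trans (m≤m+n r 3) r+3≤a+a

    2*a≡r+D : 2 * a ≡ r + D
    2*a≡r+D = trans (cong (a +_) (+-identityʳ a)) a+a≡r+D

  many-inner : 3 * (2 * a) ≤ 4 * D → κS ≥ p + ⌊ a /2⌋
  many-inner 6a≤4D = subst (λ k → κS ≥ p + k) r+γ≡⌊a/2⌋
    (from-hubs 2≤a (paired-hubs [r+γ]*2≤a γ*2≤b))
    where
    open ≤-Reasoning

    3r≤D : 3 * r ≤ D
    3r≤D = +-cancelʳ-≤ (3 * D) _ _ (begin
      3 * r + 3 * D   ≡⟨ *-distribˡ-+ 3 r D ⟨
      3 * (r + D)     ≡⟨ cong (3 *_) 2*a≡r+D ⟨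
      3 * (2 * a)     ≤⟨ 6a≤4D ⟩
      D + 3 * D       ∎)

    r+r≤a : r + r ≤ a
    r+r≤a = *-cancelˡ-≤ 2 (begin
      2 * (r + r)     ≡⟨ solve 1 (λ r → con 2 :* (r :+ r) := r :+ con 3 :* r) refl r ⟩
      r + 3 * r       ≤⟨ +-monoʳ-≤ r 3r≤D ⟩
      r + D           ≡⟨ 2*a≡r+D ⟨
      2 * a           ∎)

    γ : ℕ
    γ = ⌊ a /2⌋ ∸ r

    r+γ≡⌊a/2⌋ : r + γ ≡ ⌊ a /2⌋
    r+γ≡⌊a/2⌋ = m+[n∸m]≡n (m+m≤n⇒m≤⌊n/2⌋ {r} r+r≤a)

    [r+γ]*2≤a : (r + γ) * 2 ≤ a
    [r+γ]*2≤a = subst (λ k → k * 2 ≤ a) (sym r+γ≡⌊a/2⌋) (⌊n/2⌋*2≤n a)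

    a≤r+b : a ≤ r + b
    a≤r+b = +-cancelʳ-≤ p _ _ (≤-trans m₁≤m₂ (≤-reflexive
      (solve 3 (λ b p r → b :+ (p :+ r) := (r :+ b) :+ p) refl b p r)))

    γ*2≤b : γ * 2 ≤ b
    γ*2≤b = +-cancelˡ-≤ r _ _ (begin
      r + γ * 2       ≤⟨ m≤m+n _ r ⟩
      r + γ * 2 + r   ≡⟨ solve 2 (λ r γ → r :+ γ :* con 2 :+ r := (r :+ γ) :* con 2) refl r γ ⟩
      (r + γ) * 2     ≤⟨ [r+γ]*2≤a ⟩
      a               ≤⟨ a≤r+b ⟩
      r + b           ∎)

  all-outside : 2 * a ≤ 2 * D → κS ≥ p + r
  all-outside 2a≤2D = subst (λ k → κS ≥ p + k) (+-identityʳ r)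
    (from-hubs 2≤a (single-hubs r≤a ≤-refl))
    where
    r≤a : r ≤ a
    r≤a = +-cancelʳ-≤ a _ _
      (≤-trans (+-monoʳ-≤ r (*-cancelˡ-≤ 2 2a≤2D)) (≤-reflexive (sym a+a≡r+D)))

  all-hubs : 2 * a > 2 * D → κS ≥ a + p
  all-hubs 2a>2D = subst (κS ≥_) (trans (cong (p +_) (+-identityʳ a)) (+-comm p a))
    (from-hubs 2≤a (single-hubs ≤-refl a≤r))
    where
    a≤r : a ≤ r
    a≤r = +-cancelʳ-≤ D _ _
      (≤-trans (+-monoʳ-≤ a (<⇒≤ (*-cancelˡ-< 2 _ _ 2a>2D))) (≤-reflexive a+a≡r+D))

m≤n∸1⇒m<n : ∀ {m n} → 1 ≤ m → m ≤ n ∸ 1 → m < n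
m≤n∸1⇒m<n {n = zero}  () z≤n
m≤n∸1⇒m<n {n = suc n} _   m≤n = s≤s m≤n

outside-< : ∀ a p b q → 2 * a > (a + p) + (a + b) ∸ (b + q) → p < q
outside-< a p b q 2a>D = +-cancelˡ-< (b + 2 * a) _ _ (begin-strict
    (b + 2 * a) + p
      ≡⟨ solve 3 (λ a p b → (b :+ con 2 :* a) :+ p := (a :+ p) :+ (a :+ b)) refl a p b ⟩
    (a + p) + (a + b)
      ≤⟨ m≤n+m∸n ((a + p) + (a + b)) (b + q) ⟩
    (b + q) + ((a + p) + (a + b) ∸ (b + q))
      <⟨ +-monoʳ-< (b + q) 2a>D ⟩
    (b + q) + 2 * a
      ≡⟨ solve 3 (λ a b q → (b :+ q) :+ con 2 :* a := (b :+ con 2 :* a) :+ q) refl a b q ⟩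
    (b + 2 * a) + q ∎)
  where open ≤-Reasoning

LowerBounds : (m₁ m₂ s i κS : ℕ) → Set
LowerBounds m₁ m₂ s i κS =
  let D = m₁ + s ∸ m₂ in
    (D < 2 * i → 3 * (2 * i) ≤ 4 * D → κS ≥ (m₁ ∸ i) + ⌊ i /2⌋)
  × (4 * D < 3 * (2 * i) → 2 * i ≤ 2 * D → κS ≥ m₂ + i ∸ s)
  × (2 * i > 2 * D → κS ≥ m₁)

lower-bounds : ∀ {m₁ m₂ s i p b r κS} → i + p ≡ m₁ → i + b ≡ s → b + (p + r) ≡ m₂ →
  m₁ ≤ m₂ → s ≥ (m₂ ∸ m₁) + 3 →
  (∀ {β γ} → 2 ≤ i → Hubs i p b (p + r) β γ → κS ≥ p + (β + γ)) →
  LowerBounds m₁ m₂ s i κS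
lower-bounds {i = i} {p} {b} {r} {κS} refl refl refl m₁≤m₂ large from-hubs =
    (λ _ 6i≤4D → subst (λ k → κS ≥ k + ⌊ i /2⌋) (sym (m+n∸m≡n i p)) (many-inner 6i≤4D))
  , (λ _ 2i≤2D → subst (κS ≥_) (sym outside) (all-outside 2i≤2D))
  , all-hubs
  where
  open Bounds {i} {p} {b} {r} m₁≤m₂ large from-hubs

  outside : b + (p + r) + i ∸ (i + b) ≡ p + r
  outside = trans (cong (_∸ (i + b))
    (solve 3 (λ b q i → b :+ q :+ i := (i :+ b) :+ q) refl b (p + r) i)) (m+n∸m≡n (i + b) (p + r))

theorem3p7 :
  ∀ (m₁ m₂ s i : ℕ) →
  2 ≤ m₁ → m₁ ≤ m₂ →
  1 ⊔ (s ∸ m₂) ≤ i → i ≤ m₁ ⊓ (s ∸ 1) →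
  s ≥ (m₂ ∸ m₁) + 3 →
  2 * i > m₁ + s ∸ m₂ →
  let D  = m₁ + s ∸ m₂
      κS = κ* (K m₁ m₂) (initial m₁ m₂ i (s ∸ i))
  in
    (D < 2 * i → 3 * (2 * i) ≤ 4 * D → κS ≥ (m₁ ∸ i) + ⌊ i /2⌋)
  × (4 * D < 3 * (2 * i) → 2 * i ≤ 2 * D → κS ≥ m₂ + i ∸ s)
  × (2 * i > 2 * D → κS ≥ m₁)
theorem3p7 m₁ m₂ s i _ m₁≤m₂ lo hi large 2i>D =
  lower-bounds {κS = κ* (K m₁ m₂) (initial m₁ m₂ i (s ∸ i))} (m+[n∸m]≡n i≤m₁) (m+[n∸m]≡n (<⇒≤ i<s))
    b+[p+r]≡m₂ m₁≤m₂ large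
    (κ*-lower-bound {m₁} {m₂} {i} {m₁ ∸ i} {s ∸ i} (m+[n∸m]≡n i≤m₁) b+[p+r]≡m₂ (m<n⇒0<n∸m i<s))
  where
  p b q : ℕ
  p = m₁ ∸ i
  b = s ∸ i
  q = m₂ ∸ b

  i≤m₁ : i ≤ m₁
  i≤m₁ = m≤n⊓o⇒m≤n m₁ (s ∸ 1) hi

  i<s : i < s
  i<s = m≤n∸1⇒m<n (m⊔n≤o⇒m≤o 1 (s ∸ m₂) lo) (m≤n⊓o⇒m≤o m₁ (s ∸ 1) hi)

  b+q≡m₂ : b + q ≡ m₂
  b+q≡m₂ = m+[n∸m]≡n (m≤n+o⇒m∸n≤o s i (begin
    s              ≤⟨ m≤n+m∸n s m₂ ⟩
    m₂ + (s ∸ m₂)  ≤⟨ +-monoʳ-≤ m₂ (m⊔n≤o⇒n≤o 1 _ lo) ⟩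
    m₂ + i         ≡⟨ +-comm m₂ i ⟩
    i + m₂         ∎))
    where open ≤-Reasoning

  p<q : p < q
  p<q = outside-< i p b q (subst (2 * i >_) (sym (cong₂ _∸_
    (cong₂ _+_ (m+[n∸m]≡n i≤m₁) (m+[n∸m]≡n (<⇒≤ i<s))) b+q≡m₂)) 2i>D)

  b+[p+r]≡m₂ : b + (p + (q ∸ p)) ≡ m₂
  b+[p+r]≡m₂ = trans (cong (b +_) (m+[n∸m]≡n (<⇒≤ p<q))) b+q≡m₂
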